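{- For every even integer $d \ge 4$ and every $n \in \mathbb{N}^*$, the SONC cone $C_{n,d}$ is not closed under affine transformation of variables: there exist $f \in C_{n,d}$ and an (invertible) affine transformation $T:\mathbb{R}^n\to\mathbb{R}^n$ such that $f\circ T \notin C_{n,d}$.
   Context: $\mathbb{N}$ contains $0$ and $\mathbb{N}^* = \mathbb{N}\setminus\{0\}$. A circuit polynomial is a polynomial $f(\mathbf{x}) = \sum_{j=0}^r f_{\boldsymbol{\alpha}(j)} \mathbf{x}^{\boldsymbol{\alpha}(j)} + f_{\boldsymbol{\beta}} \mathbf{x}^{\boldsymbol{\beta}}$ in $\mathbb{R}[x_1,\dots,x_n]$ with $0\le r \le n$, exponents $\boldsymbol{\alpha}(j),\boldsymbol{\beta} \in \mathbb{N}^n$, $f_{\boldsymbol{\alpha}(j)} > 0$, $f_{\boldsymbol{\beta}} \in \mathbb{R}$, such that $\boldsymbol{\alpha}(0),\dots,\boldsymbol{\alpha}(r)$ lie in $(2\mathbb{N})^n$ and are affinely independent (so they are the vertices of a simplex), and $\boldsymbol{\beta}$ lies in the relative interior of that simplex. In particular, monomial squares $c\,\mathbf{x}^{\boldsymbol{\alpha}}$ with $c>0$ and $\boldsymbol{\alpha} \in (2\mathbb{N})^n$ count as (nonnegative) circuit polynomials. A circuit polynomial is nonnegative if it is nonnegative on all of $\mathbb{R}^n$. For even $D \ge 2$, $C_{n,D}$ is the set of SONC polynomials in $n$ variables of degree at most $D$: all $f=\sum_{i=1}^k \mu_i q_i$ of degree at most $D$ with $k\in\mathbb{N}^*$, $\mu_i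 \ge 0$ and $q_i$ nonnegative circuit polynomials. -}

module Defs where

open import Algebra.Bundles.Raw using (RawSemiring)
import Algebra.Definitions.RawSemiring as RawSemiringDefinitions
open import Data.Bool.Base using (if_then_else_)
open import Data.Fin.Base using (Fin)
import Data.Fin.Properties as Fin
open import Data.List.Base using (List; []; _∷_; _++_; foldr; cartesianProductWith)
open import Data.Nat.Base as ℕ using (ℕ; suc; _⊔_)
import Data.Nat.Divisibility as ℕ
import Data.Nat.Properties as ℕ
open import Data.Product.Base using (Σ; ∃; _×_; _,_)
open import Data.Rational.Base as ℚ using (ℚ; 0ℚ; 1ℚ)
import Data.Rational.Properties as ℚ
open import Data.Rational.Solver using (module +-*-Solver)
open import Data.Vec.Base as Vec using (Vec)
open import Data.Vec.Functional using (Vector)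
import Data.Vec.Properties as Vec
open import Level using (0ℓ)
open import Relation.Binary.PropositionalEquality using (_≡_; refl; sym; trans; cong; cong₂; module ≡-Reasoning)
open import Relation.Nullary.Decidable using (does)

------------------------------------------------------------------------
-- Real numbers
--
-- ℝ is the completion of ℚ: Cauchy sequences of rationals, with two
-- sequences identified (by _≈_) when their difference tends to 0. The
-- bounds ≤ ε are equivalent to < ε, as ε ranges over all positive
-- rationals.

Eventually : (ℕ → Set) → Set
Eventually P = ∃ λ N → ∀ n → N ℕ.≤ n → P n

IsCauchy : (ℕ → ℚ) → Set
IsCauchy s = ∀ ε → 0ℚ ℚ.< ε →
  ∃ λ N → ∀ m n → N ℕ.≤ m → N ℕ.≤ n → ℚ.∣ s m ℚ.- s n ∣ ℚ.≤ ε

record ℝ : Set where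
  constructor mkℝ
  field
    seq    : ℕ → ℚ
    cauchy : IsCauchy seq

open ℝ public

infix 4 _≈_ _≤_ _<_

record _≈_ (x y : ℝ) : Set where
  constructor mk≈
  field
    eventuallyClose : ∀ ε → 0ℚ ℚ.< ε →
      Eventually λ n → ℚ.∣ seq x n ℚ.- seq y n ∣ ℚ.≤ ε

record _≤_ (x y : ℝ) : Set where
  constructor mk≤
  field
    eventuallyBelow : ∀ ε → 0ℚ ℚ.< ε →
      Eventually λ n → seq x n ℚ.≤ seq y n ℚ.+ ε

-- A uniform positive gap is needed here: termwise strict inequality
-- would not exclude sequences with the same limit.
record _<_ (x y : ℝ) : Set where
  constructor mk<
  field
    gap             : ℚ
    gap-pos         : 0ℚ ℚ.< gap
    eventuallyApart : Eventually λ n → seq x n ℚ.+ gap ℚ.≤ seq y n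

private
  quotient : ∀ ε b → 0ℚ ℚ.< ε → 0ℚ ℚ.< b → ∃ λ δ → 0ℚ ℚ.< δ × b ℚ.* δ ≡ ε
  quotient ε b 0<ε 0<b = ε ℚ.* b⁻¹ , ℚ.positive⁻¹ (ε ℚ.* b⁻¹) {{ℚ.pos*pos⇒pos ε b⁻¹}} , (begin
    b ℚ.* (ε ℚ.* b⁻¹)  ≡⟨ solve 3 (λ b ε c → b :* (ε :* c) := (b :* c) :* ε) refl b ε b⁻¹ ⟩
    (b ℚ.* b⁻¹) ℚ.* ε  ≡⟨ cong (ℚ._* ε) (ℚ.*-inverseʳ b) ⟩
    1ℚ ℚ.* ε           ≡⟨ ℚ.*-identityˡ ε ⟩
    ε                  ∎)
    where
    open ≡-Reasoning
    open +-*-Solver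
    instance
      ε-pos : ℚ.Positive ε
      ε-pos = ℚ.positive 0<ε
      b-pos : ℚ.Positive b
      b-pos = ℚ.positive 0<b
      b-nonZero : ℚ.NonZero b
      b-nonZero = ℚ.pos⇒nonZero b
    b⁻¹ : ℚ
    b⁻¹ = ℚ.1/ b
    instance
      b⁻¹-pos : ℚ.Positive b⁻¹
      b⁻¹-pos = ℚ.1/pos⇒pos b

  0<1 : 0ℚ ℚ.< 1ℚ
  0<1 = ℚ.positive⁻¹ 1ℚ

  bounded : ∀ {s} → IsCauchy s →
            ∃ λ b → 0ℚ ℚ.< b × Eventually λ n → ℚ.∣ s n ∣ ℚ.≤ b
  bounded {s} s-cauchy with N , close ← s-cauchy 1ℚ 0<1 =
    1ℚ ℚ.+ ℚ.∣ s N ∣ ,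
    ℚ.<-≤-trans 0<1 (ℚ.≤-trans (ℚ.≤-reflexive (sym (ℚ.+-identityʳ 1ℚ)))
                               (ℚ.+-monoʳ-≤ 1ℚ (ℚ.0≤∣p∣ (s N)))) ,
    N , λ n N≤n → begin
      ℚ.∣ s n ∣                        ≡⟨ cong ℚ.∣_∣ (solve 2 (λ a b → a := (a :- b) :+ b) refl (s n) (s N)) ⟩
      ℚ.∣ (s n ℚ.- s N) ℚ.+ s N ∣      ≤⟨ ℚ.∣p+q∣≤∣p∣+∣q∣ (s n ℚ.- s N) (s N) ⟩
      ℚ.∣ s n ℚ.- s N ∣ ℚ.+ ℚ.∣ s N ∣  ≤⟨ ℚ.+-monoˡ-≤ ℚ.∣ s N ∣ (close n N N≤n ℕ.≤-refl) ⟩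
      1ℚ ℚ.+ ℚ.∣ s N ∣                 ∎
    where
    open ℚ.≤-Reasoning
    open +-*-Solver

  *-mono-∣∣ : ∀ p q {b c} → 0ℚ ℚ.≤ b → ℚ.∣ p ∣ ℚ.≤ b → ℚ.∣ q ∣ ℚ.≤ c → ℚ.∣ p ℚ.* q ∣ ℚ.≤ b ℚ.* c
  *-mono-∣∣ p q {b} {c} 0≤b ∣p∣≤b ∣q∣≤c = begin
    ℚ.∣ p ℚ.* q ∣        ≡⟨ ℚ.∣p*q∣≡∣p∣*∣q∣ p q ⟩
    ℚ.∣ p ∣ ℚ.* ℚ.∣ q ∣  ≤⟨ ℚ.*-monoʳ-≤-nonNeg ℚ.∣ q ∣ {{ℚ.nonNegative (ℚ.0≤∣p∣ q)}} ∣p∣≤b ⟩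
    b ℚ.* ℚ.∣ q ∣        ≤⟨ ℚ.*-monoˡ-≤-nonNeg b {{ℚ.nonNegative 0≤b}} ∣q∣≤c ⟩
    b ℚ.* c              ∎
    where open ℚ.≤-Reasoning

  0<+ : ∀ {p q} → 0ℚ ℚ.< p → 0ℚ ℚ.< q → 0ℚ ℚ.< p ℚ.+ q
  0<+ {p} {q} 0<p 0<q =
    ℚ.positive⁻¹ (p ℚ.+ q) {{ℚ.pos+pos⇒pos p {{ℚ.positive 0<p}} q {{ℚ.positive 0<q}}}}

  split : ∀ ε b c → 0ℚ ℚ.< ε → 0ℚ ℚ.< b → 0ℚ ℚ.< c →
          ∃ λ δ → 0ℚ ℚ.< δ × b ℚ.* δ ℚ.+ c ℚ.* δ ≡ ε
  split ε b c 0<ε 0<b 0<c =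
    let δ , 0<δ , eq = quotient ε (b ℚ.+ c) 0<ε (0<+ 0<b 0<c)
    in δ , 0<δ , trans (sym (ℚ.*-distribʳ-+ δ b c)) eq

  +-difference : ∀ a b c d → (a ℚ.+ b) ℚ.- (c ℚ.+ d) ≡ (a ℚ.- c) ℚ.+ (b ℚ.- d)
  +-difference = solve 4 (λ a b c d → (a :+ b) :- (c :+ d) := (a :- c) :+ (b :- d)) refl
    where open +-*-Solver

  *-difference : ∀ a b c d → a ℚ.* b ℚ.- c ℚ.* d ≡ a ℚ.* (b ℚ.- d) ℚ.+ d ℚ.* (a ℚ.- c)
  *-difference = solve 4 (λ a b c d → a :* b :- c :* d := a :* (b :- d) :+ d :* (a :- c)) refl
    where open +-*-Solver

-- Normalising these proofs is expensive, and only the sequences matter.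
abstract
  const-cauchy : ∀ q → IsCauchy (λ _ → q)
  const-cauchy q ε 0<ε = 0 , λ _ _ _ _ →
    ℚ.≤-trans (ℚ.≤-reflexive (cong ℚ.∣_∣ (ℚ.+-inverseʳ q))) (ℚ.<⇒≤ 0<ε)

  +-cauchy : ∀ x y → IsCauchy (λ n → seq x n ℚ.+ seq y n)
  +-cauchy (mkℝ s s-cauchy) (mkℝ t t-cauchy) ε 0<ε =
    let δ , 0<δ , δ+δ≡ε = split ε 1ℚ 1ℚ 0<ε 0<1 0<1
        M , s-close = s-cauchy δ 0<δ
        N , t-close = t-cauchy δ 0<δ
    in M ⊔ N , λ m n M⊔N≤m M⊔N≤n → begin
      ℚ.∣ (s m ℚ.+ t m) ℚ.- (s n ℚ.+ t n) ∣
        ≡⟨ cong ℚ.∣_∣ (+-difference (s m) (t m) (s n) (t n)) ⟩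
      ℚ.∣ (s m ℚ.- s n) ℚ.+ (t m ℚ.- t n) ∣
        ≤⟨ ℚ.∣p+q∣≤∣p∣+∣q∣ (s m ℚ.- s n) (t m ℚ.- t n) ⟩
      ℚ.∣ s m ℚ.- s n ∣ ℚ.+ ℚ.∣ t m ℚ.- t n ∣
        ≤⟨ ℚ.+-mono-≤ (s-close m n (ℕ.m⊔n≤o⇒m≤o M N M⊔N≤m) (ℕ.m⊔n≤o⇒m≤o M N M⊔N≤n))
                      (t-close m n (ℕ.m⊔n≤o⇒n≤o M N M⊔N≤m) (ℕ.m⊔n≤o⇒n≤o M N M⊔N≤n)) ⟩
      δ ℚ.+ δ
        ≡⟨ sym (cong₂ ℚ._+_ (ℚ.*-identityˡ δ) (ℚ.*-identityˡ δ)) ⟩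
      1ℚ ℚ.* δ ℚ.+ 1ℚ ℚ.* δ
        ≡⟨ δ+δ≡ε ⟩
      ε ∎
    where open ℚ.≤-Reasoning

  *-cauchy : ∀ x y → IsCauchy (λ n → seq x n ℚ.* seq y n)
  *-cauchy (mkℝ s s-cauchy) (mkℝ t t-cauchy) ε 0<ε =
    let b , 0<b , K , s-bound = bounded s-cauchy
        c , 0<c , L , t-bound = bounded t-cauchy
        δ , 0<δ , bδ+cδ≡ε = split ε b c 0<ε 0<b 0<c
        M , s-close = s-cauchy δ 0<δ
        N , t-close = t-cauchy δ 0<δ
    in (K ⊔ L) ⊔ (M ⊔ N) , λ m n ≤m ≤n →
      let K⊔L≤m = ℕ.m⊔n≤o⇒m≤o (K ⊔ L) (M ⊔ N) ≤m
          K⊔L≤n = ℕ.m⊔n≤o⇒m≤o (K ⊔ L) (M ⊔ N) ≤n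
          M⊔N≤m = ℕ.m⊔n≤o⇒n≤o (K ⊔ L) (M ⊔ N) ≤m
          M⊔N≤n = ℕ.m⊔n≤o⇒n≤o (K ⊔ L) (M ⊔ N) ≤n
      in begin
      ℚ.∣ s m ℚ.* t m ℚ.- s n ℚ.* t n ∣
        ≡⟨ cong ℚ.∣_∣ (*-difference (s m) (t m) (s n) (t n)) ⟩
      ℚ.∣ s m ℚ.* (t m ℚ.- t n) ℚ.+ t n ℚ.* (s m ℚ.- s n) ∣
        ≤⟨ ℚ.∣p+q∣≤∣p∣+∣q∣ (s m ℚ.* (t m ℚ.- t n)) (t n ℚ.* (s m ℚ.- s n)) ⟩
      ℚ.∣ s m ℚ.* (t m ℚ.- t n) ∣ ℚ.+ ℚ.∣ t n ℚ.* (s m ℚ.- s n) ∣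
        ≤⟨ ℚ.+-mono-≤
             (*-mono-∣∣ (s m) (t m ℚ.- t n) (ℚ.<⇒≤ 0<b) (s-bound m (ℕ.m⊔n≤o⇒m≤o K L K⊔L≤m))
                (t-close m n (ℕ.m⊔n≤o⇒n≤o M N M⊔N≤m) (ℕ.m⊔n≤o⇒n≤o M N M⊔N≤n)))
             (*-mono-∣∣ (t n) (s m ℚ.- s n) (ℚ.<⇒≤ 0<c) (t-bound n (ℕ.m⊔n≤o⇒n≤o K L K⊔L≤n))
                (s-close m n (ℕ.m⊔n≤o⇒m≤o M N M⊔N≤m) (ℕ.m⊔n≤o⇒m≤o M N M⊔N≤n))) ⟩
      b ℚ.* δ ℚ.+ c ℚ.* δ
        ≡⟨ bδ+cδ≡ε ⟩
      ε ∎
    where open ℚ.≤-Reasoning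

fromℚ : ℚ → ℝ
fromℚ q = mkℝ (λ _ → q) (const-cauchy q)

infixl 6 _+_
infixl 7 _*_

_+_ : ℝ → ℝ → ℝ
x + y = mkℝ (λ n → seq x n ℚ.+ seq y n) (+-cauchy x y)

_*_ : ℝ → ℝ → ℝ
x * y = mkℝ (λ n → seq x n ℚ.* seq y n) (*-cauchy x y)

0ℝ 1ℝ : ℝ
0ℝ = fromℚ 0ℚ
1ℝ = fromℚ 1ℚ

ℝ-rawSemiring : RawSemiring 0ℓ 0ℓ
ℝ-rawSemiring = record
  { Carrier = ℝ ; _≈_ = _≈_ ; _+_ = _+_ ; _*_ = _*_ ; 0# = 0ℝ ; 1# = 1ℝ }

-- Finite sums and products over Fin k, and powers, of real numbers.
module ℝ-Ops = RawSemiringDefinitions ℝ-rawSemiring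
open ℝ-Ops using () renaming (sum to ∑; product to ∏; _^_ to _^ᴿ_)

fromℕ : ℕ → ℝ
fromℕ k = k ℝ-Ops.× 1ℝ

------------------------------------------------------------------------
-- Polynomials in ℝ[x₁,…,xₙ]

Exponent : ℕ → Set
Exponent n = Vec ℕ n

∣_∣ₑ : ∀ {n} → Exponent n → ℕ
∣ α ∣ₑ = Vec.sum α

-- A list of terms stands for the sum of these terms; the same exponent
-- may occur several times, and coefficients may be zero. Equality of
-- polynomials is therefore _≈ₚ_ below.
Poly : ℕ → Set
Poly n = List (ℝ × Exponent n)

coeff : ∀ {n} → Poly n → Exponent n → ℝ
coeff []            α = 0ℝ
coeff ((c , γ) ∷ p) α =
  if does (Vec.≡-dec ℕ._≟_ γ α) then c + coeff p α else coeff p α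

infix 4 _≈ₚ_
_≈ₚ_ : ∀ {n} → Poly n → Poly n → Set
p ≈ₚ q = ∀ α → coeff p α ≈ coeff q α

DegreeAtMost : ∀ {n} → ℕ → Poly n → Set
DegreeAtMost D p = ∀ α → D ℕ.< ∣ α ∣ₑ → coeff p α ≈ 0ℝ

eval : ∀ {n} → Poly n → Vector ℝ n → ℝ
eval p x = foldr (λ (c , α) v → c * ∏ (λ i → x i ^ᴿ Vec.lookup α i) + v) 0ℝ p

monomial : ∀ {n} → ℝ → Exponent n → Poly n
monomial c α = (c , α) ∷ []

const : ∀ {n} → ℝ → Poly n
const c = monomial c (Vec.replicate _ 0)

var : ∀ {n} → Fin n → Poly n
var i = monomial 1ℝ (Vec.replicate _ 0 Vec.[ i ]≔ 1)

infixl 6 _+ₚ_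
infixl 7 _*ₚ_

_+ₚ_ : ∀ {n} → Poly n → Poly n → Poly n
_+ₚ_ = _++_

_*ₚ_ : ∀ {n} → Poly n → Poly n → Poly n
_*ₚ_ = cartesianProductWith λ (c , α) (d , β) → c * d , Vec.zipWith ℕ._+_ α β

Poly-rawSemiring : ℕ → RawSemiring 0ℓ 0ℓ
Poly-rawSemiring n = record
  { Carrier = Poly n ; _≈_ = _≈ₚ_ ; _+_ = _+ₚ_ ; _*_ = _*ₚ_ ; 0# = [] ; 1# = const 1ℝ }

module Poly-Ops {n} = RawSemiringDefinitions (Poly-rawSemiring n)
open Poly-Ops using () renaming (sum to ∑ₚ; product to ∏ₚ; _^_ to _^ₚ_)

------------------------------------------------------------------------
-- Affine transformations of variables

-- The map x ↦ A x + b.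
record AffineMap (n : ℕ) : Set where
  field
    A : Fin n → Fin n → ℝ
    b : Vector ℝ n

identityMatrix : ∀ {n} → Fin n → Fin n → ℝ
identityMatrix i j = if does (i Fin.≟ j) then 1ℝ else 0ℝ

matMul : ∀ {n} → (Fin n → Fin n → ℝ) → (Fin n → Fin n → ℝ) → (Fin n → Fin n → ℝ)
matMul A B i k = ∑ λ j → A i j * B j k

Invertible : ∀ {n} → AffineMap n → Set
Invertible {n} T = Σ (Fin n → Fin n → ℝ) λ B →
  (∀ i j → matMul A B i j ≈ identityMatrix i j) ×
  (∀ i j → matMul B A i j ≈ identityMatrix i j)
  where open AffineMap T

-- The i-th coordinate of T(x), as a polynomial of degree at most 1 in x.
component : ∀ {n} → AffineMap n → Fin n → Poly n
component T i = ∑ₚ (λ j → const (A i j) *ₚ var j) +ₚ const (b i)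
  where open AffineMap T

-- f ∘ T as a polynomial: substitute T₁(x),…,Tₙ(x) for the variables of f.
infixr 9 _∘ₚ_
_∘ₚ_ : ∀ {n} → Poly n → AffineMap n → Poly n
f ∘ₚ T =
  foldr (λ (c , α) p → (const c *ₚ ∏ₚ (λ i → component T i ^ₚ Vec.lookup α i)) +ₚ p) [] f

------------------------------------------------------------------------
-- Circuit polynomials and the SONC cone

EvenExponent : ∀ {n} → Exponent n → Set
EvenExponent α = ∀ i → 2 ℕ.∣ Vec.lookup α i

AffinelyIndependent : ∀ {n k} → Vector (Exponent n) k → Set
AffinelyIndependent {n} {k} α = (c : Vector ℝ k) →
  ∑ c ≈ 0ℝ →
  (∀ i → ∑ (λ j → c j * fromℕ (Vec.lookup (α j) i)) ≈ 0ℝ) →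
  ∀ j → c j ≈ 0ℝ

-- The relative interior of a simplex consists of the convex
-- combinations of its vertices with all weights strictly positive. In
-- particular a single point is its own relative interior.
InRelativeInterior : ∀ {n k} → Vector (Exponent n) k → Exponent n → Set
InRelativeInterior {n} {k} α β = Σ (Vector ℝ k) λ w →
  (∀ j → 0ℝ < w j) ×
  ∑ w ≈ 1ℝ ×
  (∀ i → ∑ (λ j → w j * fromℕ (Vec.lookup (α j) i)) ≈ fromℕ (Vec.lookup β i))

-- ∑ⱼ aⱼ x^α(j) + b x^β
circuitForm : ∀ {n k} → Vector ℝ k → Vector (Exponent n) k → ℝ → Exponent n → Poly n
circuitForm a α b β = ∑ₚ (λ j → monomial (a j) (α j)) +ₚ monomial b β

record IsCircuitPolynomial {n : ℕ} (f : Poly n) : Set where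
  field
    r           : ℕ
    r≤n         : r ℕ.≤ n
    α           : Vector (Exponent n) (suc r)
    β           : Exponent n
    f-α         : Vector ℝ (suc r)
    f-β         : ℝ
    f-α-pos     : ∀ j → 0ℝ < f-α j
    α-even      : ∀ j → EvenExponent (α j)
    α-affIndep  : AffinelyIndependent α
    β-interior  : InRelativeInterior α β
    f-form      : f ≈ₚ circuitForm f-α α f-β β

Nonnegative : ∀ {n} → Poly n → Set
Nonnegative {n} f = (x : Vector ℝ n) → 0ℝ ≤ eval f x

-- Membership of f in C_{n,D}. The degree bound is on f only, not on the qᵢ.
record C (n D : ℕ) (f : Poly n) : Set where
  field
    degree        : DegreeAtMost D f
    k             : ℕ
    k-nonZero     : ℕ.NonZero k
    μ             : Vector ℝ k
    q             : Vector (Poly n) k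
    μ-nonneg      : ∀ i → 0ℝ ≤ μ i
    q-circuit     : ∀ i → IsCircuitPolynomial (q i)
    q-nonneg      : ∀ i → Nonnegative (q i)
    decomposition : f ≈ₚ ∑ₚ (λ i → const (μ i) *ₚ q i)

{-# OPTIONS --safe #-}

-- Take f = x₁⁴, a monomial square, and translate x₁ by 1. The result (x₁ + 1)⁴
-- is separated from the SONC cone by the linear functional L that maps x^γ to
-- χ(γ₁), where χ(k) = (-1)^k max(2^k, 2^(4-k)).
--
-- L is nonnegative on every nonnegative circuit polynomial q. For even k both
-- (-2)^k and 16 (-1/2)^k are at most χ(k), and for any k one of them equals
-- χ(k). Choose the one that is exact at the inner exponent β: since the outer
-- coefficients are positive and their exponents even, L(q) is at least
-- q(-2,1,…,1) or 16 q(-1/2,1,…,1), hence nonnegative.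
--
-- On the other hand L((x₁ + 1)⁴) = 16 - 4·8 + 6·4 - 4·8 + 16 = -8.

module Submission where

open import Data.Nat.Base using (ℕ; _≤_; NonZero)
open import Data.Nat.Divisibility using (_∣_)
open import Data.Product.Base using (Σ; _×_)
open import Relation.Nullary using (¬_)
open import Defs using (Poly; AffineMap; Invertible; _∘ₚ_; C)

open import Algebra.Bundles using (CommutativeRing)
import Algebra.Properties.Semiring.Exp as Exp
open import Data.Bool.Base using (true; false; if_then_else_)
open import Data.Empty using (⊥-elim)
open import Data.Fin.Base using (Fin; zero; suc)
open import Data.List.Base using (List; []; _∷_; _++_; foldr; map; deduplicate)
open import Data.List.Membership.Propositional using (_∈_)
open import Data.List.Membership.Propositional.Properties using (∈-deduplicate⁺; ∈-++⁺ˡ; ∈-++⁺ʳ)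
open import Data.List.Relation.Unary.All using (All; []; _∷_; lookup; tabulate)
open import Data.List.Relation.Unary.AllPairs using ([]; _∷_)
open import Data.List.Relation.Unary.Any using (here; there)
open import Data.List.Relation.Unary.Unique.Propositional using (Unique)
import Data.List.Relation.Unary.Unique.DecPropositional.Properties as UniqueDec
open import Data.Nat.Base as ℕ using (zero; suc; z≤n; s≤s)
import Data.Nat.Divisibility as ℕ
import Data.Nat.Properties as ℕ
open import Data.Product.Base using (∃; _,_; proj₁; proj₂)
open import Data.Rational.Base as ℚ using (ℚ; 0ℚ; 1ℚ; ½)
import Data.Rational.Properties as ℚ
open import Data.Rational.Solver using (module +-*-Solver)
open import Data.Sum.Base using (inj₁; inj₂)
open import Data.Vec.Base as Vec using ([]; _∷_)
open import Data.Vec.Functional using (Vector)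
import Data.Vec.Properties as Vec
open import Function.Base using (_∘_)
open import Relation.Binary.PropositionalEquality
  using (_≡_; _≢_; refl; sym; trans; cong; cong₂; subst; module ≡-Reasoning)
open import Relation.Nullary.Decidable using (Dec; yes; no; does; from-yes; from-no; dec-true; dec-false)
open import Defs
  renaming (_≈_ to _≈ᴿ_; _≤_ to _≤ᴿ_; _<_ to _<ᴿ_; _+_ to _+ᴿ_; _*_ to _*ᴿ_)
  hiding (Poly; AffineMap; Invertible; _∘ₚ_; C)

open ℝ-Ops using () renaming (sum to ∑; product to ∏; _^_ to _^ᴿ_)
open Poly-Ops using () renaming (sum to ∑ₚ; product to ∏ₚ; _^_ to _^ₚ_)
open Exp (CommutativeRing.semiring ℚ.+-*-commutativeRing) using (_^_; ^-assocʳ)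

-- Order and division in the rationals.

p≤∣p∣ : ∀ p → p ℚ.≤ ℚ.∣ p ∣
p≤∣p∣ p with ℚ.≤-total 0ℚ p
... | inj₁ 0≤p = ℚ.≤-reflexive (sym (ℚ.0≤p⇒∣p∣≡p 0≤p))
... | inj₂ p≤0 = ℚ.≤-trans p≤0 (ℚ.0≤∣p∣ p)

0≤* : ∀ {p q} → 0ℚ ℚ.≤ p → 0ℚ ℚ.≤ q → 0ℚ ℚ.≤ p ℚ.* q
0≤* {p} {q} 0≤p 0≤q =
  ℚ.nonNegative⁻¹ (p ℚ.* q) {{ℚ.nonNeg*nonNeg⇒nonNeg p {{ℚ.nonNegative 0≤p}} q {{ℚ.nonNegative 0≤q}}}}

0≤p*p : ∀ p → 0ℚ ℚ.≤ p ℚ.* p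
0≤p*p p with ℚ.≤-total 0ℚ p
... | inj₁ 0≤p = 0≤* 0≤p 0≤p
... | inj₂ p≤0 = ℚ.nonNegative⁻¹ (p ℚ.* p)
  {{ℚ.nonPos*nonPos⇒nonPos p {{ℚ.nonPositive p≤0}} p {{ℚ.nonPositive p≤0}}}}

divide : ∀ ε b → 0ℚ ℚ.< ε → 0ℚ ℚ.< b → ∃ λ δ → 0ℚ ℚ.< δ × b ℚ.* δ ≡ ε
divide ε b 0<ε 0<b = ε ℚ.* b⁻¹ , ℚ.positive⁻¹ (ε ℚ.* b⁻¹) {{ℚ.pos*pos⇒pos ε b⁻¹}} , (begin
  b ℚ.* (ε ℚ.* b⁻¹)  ≡⟨ solve 3 (λ b ε c → b :* (ε :* c) := (b :* c) :* ε) refl b ε b⁻¹ ⟩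
  (b ℚ.* b⁻¹) ℚ.* ε  ≡⟨ cong (ℚ._* ε) (ℚ.*-inverseʳ b) ⟩
  1ℚ ℚ.* ε           ≡⟨ ℚ.*-identityˡ ε ⟩
  ε                  ∎)
  where
  open ≡-Reasoning
  open +-*-Solver
  instance
    ε-pos : ℚ.Positive ε
    ε-pos = ℚ.positive 0<ε
    b-pos : ℚ.Positive b
    b-pos = ℚ.positive 0<b
    b-nonZero : ℚ.NonZero b
    b-nonZero = ℚ.pos⇒nonZero b
  b⁻¹ : ℚ
  b⁻¹ = ℚ.1/ b
  instance
    b⁻¹-pos : ℚ.Positive b⁻¹
    b⁻¹-pos = ℚ.1/pos⇒pos b

halve : ∀ ε → 0ℚ ℚ.< ε → ∃ λ δ → 0ℚ ℚ.< δ × δ ℚ.+ δ ≡ ε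
halve ε 0<ε =
  let δ , 0<δ , eq = divide ε (1ℚ ℚ.+ 1ℚ) 0<ε (ℚ.positive⁻¹ (1ℚ ℚ.+ 1ℚ)) in
  δ , 0<δ , trans (cong₂ ℚ._+_ (sym (ℚ.*-identityˡ δ)) (sym (ℚ.*-identityˡ δ)))
                  (trans (sym (ℚ.*-distribʳ-+ δ 1ℚ 1ℚ)) eq)

0<1+ : ∀ {p} → 0ℚ ℚ.≤ p → 0ℚ ℚ.< 1ℚ ℚ.+ p
0<1+ 0≤p = ℚ.<-≤-trans (ℚ.positive⁻¹ 1ℚ) (ℚ.≤-trans (ℚ.≤-reflexive (sym (ℚ.+-identityʳ 1ℚ))) (ℚ.+-monoʳ-≤ 1ℚ 0≤p))

-- Equality and order of Cauchy reals.

always : ∀ {P : ℕ → Set} → (∀ n → P n) → Eventually P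
always p = 0 , λ n _ → p n

both : ∀ {P Q : ℕ → Set} → Eventually P → Eventually Q → Eventually (λ n → P n × Q n)
both (M , p) (N , q) = M ℕ.⊔ N , λ n M⊔N≤n →
  p n (ℕ.m⊔n≤o⇒m≤o M N M⊔N≤n) , q n (ℕ.m⊔n≤o⇒n≤o M N M⊔N≤n)

eventually-map : ∀ {P Q : ℕ → Set} → (∀ n → P n → Q n) → Eventually P → Eventually Q
eventually-map f (N , p) = N , λ n N≤n → f n (p n N≤n)

infix 4 _≐_
-- Identities that come from the ring laws of ℚ hold at every index, so they are proved termwise and
-- weakened by `≐⇒≈` only where they meet equalities that hold in the limit.
_≐_ : ℝ → ℝ → Set
x ≐ y = ∀ n → seq x n ≡ seq y n

≐⇒≈ : ∀ {x y} → x ≐ y → x ≈ᴿ y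
≐⇒≈ {x} {y} x≐y = mk≈ λ ε 0<ε → always λ n →
  ℚ.≤-trans (ℚ.≤-reflexive (cong ℚ.∣_∣ (trans (cong (ℚ._- seq y n) (x≐y n)) (ℚ.+-inverseʳ (seq y n)))))
            (ℚ.<⇒≤ 0<ε)

≈-sym : ∀ {x y} → x ≈ᴿ y → y ≈ᴿ x
≈-sym {x} {y} (mk≈ close) = mk≈ λ ε 0<ε → eventually-map
  (λ n → ℚ.≤-trans (ℚ.≤-reflexive (trans (cong ℚ.∣_∣ (swap (seq y n) (seq x n))) (ℚ.∣-p∣≡∣p∣ (seq x n ℚ.- seq y n)))))
  (close ε 0<ε)
  where
  open +-*-Solver
  swap : ∀ a b → a ℚ.- b ≡ ℚ.- (b ℚ.- a)
  swap = solve 2 (λ a b → a :- b := :- (b :- a)) refl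

≈-trans : ∀ {x y z} → x ≈ᴿ y → y ≈ᴿ z → x ≈ᴿ z
≈-trans {x} {y} {z} (mk≈ xy) (mk≈ yz) = mk≈ λ ε 0<ε →
  let δ , 0<δ , δ+δ≡ε = halve ε 0<ε in
  eventually-map (λ n (p , q) → begin
    ℚ.∣ seq x n ℚ.- seq z n ∣
      ≡⟨ cong ℚ.∣_∣ (solve 3 (λ a b c → a :- c := (a :- b) :+ (b :- c)) refl (seq x n) (seq y n) (seq z n)) ⟩
    ℚ.∣ (seq x n ℚ.- seq y n) ℚ.+ (seq y n ℚ.- seq z n) ∣
      ≤⟨ ℚ.∣p+q∣≤∣p∣+∣q∣ (seq x n ℚ.- seq y n) (seq y n ℚ.- seq z n) ⟩
    ℚ.∣ seq x n ℚ.- seq y n ∣ ℚ.+ ℚ.∣ seq y n ℚ.- seq z n ∣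
      ≤⟨ ℚ.+-mono-≤ p q ⟩
    δ ℚ.+ δ ≡⟨ δ+δ≡ε ⟩
    ε ∎)
  (both (xy δ 0<δ) (yz δ 0<δ))
  where
  open ℚ.≤-Reasoning
  open +-*-Solver

+-cong : ∀ {x y u v} → x ≈ᴿ y → u ≈ᴿ v → x +ᴿ u ≈ᴿ y +ᴿ v
+-cong {x} {y} {u} {v} (mk≈ xy) (mk≈ uv) = mk≈ λ ε 0<ε →
  let δ , 0<δ , δ+δ≡ε = halve ε 0<ε in
  eventually-map (λ n (p , q) → begin
    ℚ.∣ (seq x n ℚ.+ seq u n) ℚ.- (seq y n ℚ.+ seq v n) ∣
      ≡⟨ cong ℚ.∣_∣ (solve 4 (λ a b c d → (a :+ b) :- (c :+ d) := (a :- c) :+ (b :- d)) refl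
                             (seq x n) (seq u n) (seq y n) (seq v n)) ⟩
    ℚ.∣ (seq x n ℚ.- seq y n) ℚ.+ (seq u n ℚ.- seq v n) ∣
      ≤⟨ ℚ.∣p+q∣≤∣p∣+∣q∣ (seq x n ℚ.- seq y n) (seq u n ℚ.- seq v n) ⟩
    ℚ.∣ seq x n ℚ.- seq y n ∣ ℚ.+ ℚ.∣ seq u n ℚ.- seq v n ∣
      ≤⟨ ℚ.+-mono-≤ p q ⟩
    δ ℚ.+ δ ≡⟨ δ+δ≡ε ⟩
    ε ∎)
  (both (xy δ 0<δ) (uv δ 0<δ))
  where
  open ℚ.≤-Reasoning
  open +-*-Solver

*-congʳ : ∀ {x y} c → x ≈ᴿ y → x *ᴿ fromℚ c ≈ᴿ y *ᴿ fromℚ c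
*-congʳ {x} {y} c (mk≈ xy) = mk≈ λ ε 0<ε →
  -- The summand `1ℚ` keeps the divisor positive when `c` is 0.
  let δ , 0<δ , eq = divide ε (1ℚ ℚ.+ ℚ.∣ c ∣) 0<ε (0<1+ (ℚ.0≤∣p∣ c)) in
  eventually-map (λ n p → begin
    ℚ.∣ seq x n ℚ.* c ℚ.- seq y n ℚ.* c ∣
      ≡⟨ cong ℚ.∣_∣ (solve 3 (λ a b c → a :* c :- b :* c := (a :- b) :* c) refl (seq x n) (seq y n) c) ⟩
    ℚ.∣ (seq x n ℚ.- seq y n) ℚ.* c ∣
      ≡⟨ ℚ.∣p*q∣≡∣p∣*∣q∣ (seq x n ℚ.- seq y n) c ⟩
    ℚ.∣ seq x n ℚ.- seq y n ∣ ℚ.* ℚ.∣ c ∣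
      ≤⟨ ℚ.*-monoʳ-≤-nonNeg ℚ.∣ c ∣ {{ℚ.nonNegative (ℚ.0≤∣p∣ c)}} p ⟩
    δ ℚ.* ℚ.∣ c ∣
      ≡⟨ ℚ.+-identityˡ (δ ℚ.* ℚ.∣ c ∣) ⟨
    0ℚ ℚ.+ δ ℚ.* ℚ.∣ c ∣
      ≤⟨ ℚ.+-monoˡ-≤ (δ ℚ.* ℚ.∣ c ∣) (ℚ.<⇒≤ 0<δ) ⟩
    δ ℚ.+ δ ℚ.* ℚ.∣ c ∣
      ≡⟨ solve 2 (λ d c → d :+ d :* c := (con 1ℚ :+ c) :* d) refl δ ℚ.∣ c ∣ ⟩
    (1ℚ ℚ.+ ℚ.∣ c ∣) ℚ.* δ ≡⟨ eq ⟩
    ε ∎)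
  (xy δ 0<δ)
  where
  open ℚ.≤-Reasoning
  open +-*-Solver

0≤-resp-≈ : ∀ {x y} → x ≈ᴿ y → 0ℝ ≤ᴿ x → 0ℝ ≤ᴿ y
0≤-resp-≈ {x} {y} (mk≈ xy) (mk≤ 0≤x) = mk≤ λ ε 0<ε →
  let δ , 0<δ , δ+δ≡ε = halve ε 0<ε in
  eventually-map (λ n (p , q) → begin
    0ℚ                 ≤⟨ p ⟩
    seq x n ℚ.+ δ
      ≡⟨ solve 3 (λ a b d → a :+ d := b :+ ((a :- b) :+ d)) refl (seq x n) (seq y n) δ ⟩
    seq y n ℚ.+ ((seq x n ℚ.- seq y n) ℚ.+ δ)
      ≤⟨ ℚ.+-monoʳ-≤ (seq y n) (ℚ.+-monoˡ-≤ δ (ℚ.≤-trans (p≤∣p∣ _) q)) ⟩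
    seq y n ℚ.+ (δ ℚ.+ δ) ≡⟨ cong (seq y n ℚ.+_) δ+δ≡ε ⟩
    seq y n ℚ.+ ε ∎)
  (both (0≤x δ 0<δ) (xy δ 0<δ))
  where
  open ℚ.≤-Reasoning
  open +-*-Solver

0≤-mono : ∀ {x y} → Eventually (λ n → seq x n ℚ.≤ seq y n) → 0ℝ ≤ᴿ x → 0ℝ ≤ᴿ y
0≤-mono x≤y (mk≤ 0≤x) = mk≤ λ ε 0<ε → eventually-map
  (λ n (p , q) → ℚ.≤-trans p (ℚ.+-monoˡ-≤ ε q)) (both (0≤x ε 0<ε) x≤y)

0≤-pointwise : ∀ {x} → (∀ n → 0ℚ ℚ.≤ seq x n) → 0ℝ ≤ᴿ x
0≤-pointwise {x} 0≤x = mk≤ λ ε 0<ε → always λ n →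
  ℚ.≤-trans (0≤x n) (ℚ.≤-trans (ℚ.≤-reflexive (sym (ℚ.+-identityʳ (seq x n)))) (ℚ.+-monoʳ-≤ (seq x n) (ℚ.<⇒≤ 0<ε)))

0≤+ : ∀ {x y} → 0ℝ ≤ᴿ x → 0ℝ ≤ᴿ y → 0ℝ ≤ᴿ x +ᴿ y
0≤+ {x} {y} (mk≤ 0≤x) (mk≤ 0≤y) = mk≤ λ ε 0<ε →
  let δ , 0<δ , δ+δ≡ε = halve ε 0<ε in
  eventually-map (λ n (p , q) → begin
    0ℚ                                     ≤⟨ ℚ.+-mono-≤ p q ⟩
    (seq x n ℚ.+ δ) ℚ.+ (seq y n ℚ.+ δ)
      ≡⟨ solve 3 (λ a b d → (a :+ d) :+ (b :+ d) := (a :+ b) :+ (d :+ d)) refl (seq x n) (seq y n) δ ⟩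
    (seq x n ℚ.+ seq y n) ℚ.+ (δ ℚ.+ δ)    ≡⟨ cong ((seq x n ℚ.+ seq y n) ℚ.+_) δ+δ≡ε ⟩
    (seq x n ℚ.+ seq y n) ℚ.+ ε            ∎)
  (both (0≤x δ 0<δ) (0≤y δ 0<δ))
  where
  open ℚ.≤-Reasoning
  open +-*-Solver

bounded-above : ∀ x → ∃ λ b → 0ℚ ℚ.≤ b × Eventually λ n → seq x n ℚ.≤ b
bounded-above (mkℝ s s-cauchy) with N , close ← s-cauchy 1ℚ (ℚ.positive⁻¹ 1ℚ) =
  1ℚ ℚ.+ ℚ.∣ s N ∣ , ℚ.<⇒≤ (0<1+ (ℚ.0≤∣p∣ (s N))) , N , λ n N≤n → begin
    s n                    ≡⟨ solve 2 (λ a b → a := (a :- b) :+ b) refl (s n) (s N) ⟩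
    (s n ℚ.- s N) ℚ.+ s N  ≤⟨ ℚ.+-mono-≤ (ℚ.≤-trans (p≤∣p∣ _) (close n N N≤n ℕ.≤-refl)) (p≤∣p∣ (s N)) ⟩
    1ℚ ℚ.+ ℚ.∣ s N ∣       ∎
  where
  open ℚ.≤-Reasoning
  open +-*-Solver

-- A nonnegative real may have negative terms, so the terms themselves cannot be multiplied. Both
-- are first shifted up by a small `δ`, and the excess (x + δ)(y + δ) - xy = (x + y + δ)δ is kept
-- below `ε`.
0≤*ᴿ : ∀ {x y} → 0ℝ ≤ᴿ x → 0ℝ ≤ᴿ y → 0ℝ ≤ᴿ x *ᴿ y
0≤*ᴿ {x} {y} (mk≤ 0≤x) (mk≤ 0≤y) = mk≤ λ ε 0<ε →
  let b , 0≤b , x≤b = bounded-above x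
      c , 0≤c , y≤c = bounded-above y
      -- `K` bounds x + y + δ once δ ≤ ε, and dividing `ε` by 1 + K secures both δ ≤ ε and Kδ ≤ ε.
      K = b ℚ.+ c ℚ.+ ε
      0≤K : 0ℚ ℚ.≤ K
      0≤K = ℚ.+-mono-≤ (ℚ.+-mono-≤ 0≤b 0≤c) (ℚ.<⇒≤ 0<ε)
      δ , 0<δ , eq = divide ε (1ℚ ℚ.+ K) 0<ε (0<1+ 0≤K)
      0≤δ = ℚ.<⇒≤ 0<δ
      δ≤ε : δ ℚ.≤ ε
      δ≤ε = begin
        δ                     ≡⟨ ℚ.+-identityʳ δ ⟨
        δ ℚ.+ 0ℚ              ≤⟨ ℚ.+-monoʳ-≤ δ (0≤* 0≤K 0≤δ) ⟩
        δ ℚ.+ K ℚ.* δ         ≡⟨ solve 2 (λ d k → d :+ k :* d := (con 1ℚ :+ k) :* d) refl δ K ⟩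
        (1ℚ ℚ.+ K) ℚ.* δ      ≡⟨ eq ⟩
        ε                     ∎
  in
  eventually-map (λ n ((p , q) , (u , v)) → begin
    0ℚ
      ≤⟨ 0≤* p q ⟩
    (seq x n ℚ.+ δ) ℚ.* (seq y n ℚ.+ δ)
      ≡⟨ solve 3 (λ a b d → (a :+ d) :* (b :+ d) := a :* b :+ (a :+ b :+ d) :* d) refl (seq x n) (seq y n) δ ⟩
    seq x n ℚ.* seq y n ℚ.+ (seq x n ℚ.+ seq y n ℚ.+ δ) ℚ.* δ
      ≤⟨ ℚ.+-monoʳ-≤ (seq x n ℚ.* seq y n)
           (ℚ.*-monoʳ-≤-nonNeg δ {{ℚ.nonNegative 0≤δ}} (ℚ.+-mono-≤ (ℚ.+-mono-≤ u v) δ≤ε)) ⟩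
    seq x n ℚ.* seq y n ℚ.+ K ℚ.* δ
      ≤⟨ ℚ.+-monoʳ-≤ (seq x n ℚ.* seq y n) (ℚ.≤-trans (ℚ.≤-reflexive (sym (ℚ.+-identityˡ (K ℚ.* δ))))
                                                    (ℚ.+-monoˡ-≤ (K ℚ.* δ) 0≤δ)) ⟩
    seq x n ℚ.* seq y n ℚ.+ (δ ℚ.+ K ℚ.* δ)
      ≡⟨ cong (seq x n ℚ.* seq y n ℚ.+_)
              (trans (solve 2 (λ d k → d :+ k :* d := (con 1ℚ :+ k) :* d) refl δ K) eq) ⟩
    seq x n ℚ.* seq y n ℚ.+ ε ∎)
  (both (both (0≤x δ 0<δ) (0≤y δ 0<δ)) (both x≤b y≤c))
  where
  open ℚ.≤-Reasoning
  open +-*-Solver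

-- Linear functionals on polynomials, given by rational weights on exponents.

pair : ∀ {n} → (Exponent n → ℚ) → Poly n → ℝ
pair φ = foldr (λ (c , γ) v → c *ᴿ fromℚ (φ γ) +ᴿ v) 0ℝ

pair-++ : ∀ {n} (φ : Exponent n → ℚ) p q → pair φ (p ++ q) ≐ pair φ p +ᴿ pair φ q
pair-++ φ []            q N = sym (ℚ.+-identityˡ _)
pair-++ φ ((c , γ) ∷ p) q N =
  trans (cong (seq c N ℚ.* φ γ ℚ.+_) (pair-++ φ p q N)) (sym (ℚ.+-assoc (seq c N ℚ.* φ γ) _ _))

pair-∑ₚ : ∀ {n k} (φ : Exponent n → ℚ) (p : Vector (Poly n) k) → pair φ (∑ₚ p) ≐ ∑ (pair φ ∘ p)
pair-∑ₚ {k = zero}  φ p N = refl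
pair-∑ₚ {k = suc k} φ p N =
  trans (pair-++ φ (p zero) _ N) (cong (seq (pair φ (p zero)) N ℚ.+_) (pair-∑ₚ φ (p ∘ suc) N))

pair-ext : ∀ {n} {φ ψ : Exponent n → ℚ} → (∀ γ → φ γ ≡ ψ γ) → ∀ p → pair φ p ≐ pair ψ p
pair-ext φ≗ψ []            N = refl
pair-ext φ≗ψ ((c , γ) ∷ p) N = cong₂ ℚ._+_ (cong (seq c N ℚ.*_) (φ≗ψ γ)) (pair-ext φ≗ψ p N)

pair-scale : ∀ {n} (s : ℚ) (φ : Exponent n → ℚ) p → pair (λ γ → s ℚ.* φ γ) p ≐ fromℚ s *ᴿ pair φ p
pair-scale s φ []            N = sym (ℚ.*-zeroʳ s)
pair-scale s φ ((c , γ) ∷ p) N =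
  trans (cong (seq c N ℚ.* (s ℚ.* φ γ) ℚ.+_) (pair-scale s φ p N))
        (solve 4 (λ s c f v → c :* (s :* f) :+ s :* v := s :* (c :* f :+ v)) refl s (seq c N) (φ γ) _)
  where open +-*-Solver

infixl 6 _⊕_
_⊕_ : ∀ {n} → Exponent n → Exponent n → Exponent n
_⊕_ = Vec.zipWith ℕ._+_

⊕-identityˡ : ∀ {n} (γ : Exponent n) → Vec.replicate n 0 ⊕ γ ≡ γ
⊕-identityˡ = Vec.zipWith-identityˡ ℕ.+-identityˡ

⊕-identityʳ : ∀ {n} (γ : Exponent n) → γ ⊕ Vec.replicate n 0 ≡ γ
⊕-identityʳ = Vec.zipWith-identityʳ ℕ.+-identityʳ

pair-map : ∀ {n} (φ : Exponent n → ℚ) c α (q : Poly n) →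
  pair φ (map (λ (d , β) → c *ᴿ d , α ⊕ β) q) ≐ c *ᴿ pair (λ β → φ (α ⊕ β)) q
pair-map φ c α []            N = sym (ℚ.*-zeroʳ (seq c N))
pair-map φ c α ((d , β) ∷ q) N =
  trans (cong (seq c N ℚ.* seq d N ℚ.* φ (α ⊕ β) ℚ.+_) (pair-map φ c α q N))
        (solve 4 (λ c d f v → c :* d :* f :+ c :* v := c :* (d :* f :+ v)) refl (seq c N) (seq d N) (φ (α ⊕ β)) _)
  where open +-*-Solver

-- Fixing the index `N` turns the value of the inner functional into a rational, hence an admissible
-- weight for the outer one. This is why the statement speaks of terms at `N` instead of using
-- `_≐_`.
pair-* : ∀ {n} (φ : Exponent n → ℚ) p q N →
  seq (pair φ (p *ₚ q)) N ≡ seq (pair (λ α → seq (pair (λ β → φ (α ⊕ β)) q) N) p) N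
pair-* φ []            q N = refl
pair-* φ ((c , α) ∷ p) q N =
  trans (pair-++ φ (map _ q) _ N) (cong₂ ℚ._+_ (pair-map φ c α q N) (pair-* φ p q N))

pair-const : ∀ {n} (φ : Exponent n → ℚ) c → pair φ (const c) ≐ c *ᴿ fromℚ (φ (Vec.replicate n 0))
pair-const φ c N = ℚ.+-identityʳ _

pair-const-* : ∀ {n} (φ : Exponent n → ℚ) c q → pair φ (const c *ₚ q) ≐ c *ᴿ pair φ q
pair-const-* φ c q N = trans (pair-* φ (const c) q N)
  (trans (pair-const (λ α → seq (pair (λ β → φ (α ⊕ β)) q) N) c N)
         (cong (seq c N ℚ.*_) (pair-ext (λ γ → cong φ (⊕-identityˡ γ)) q N)))

-- Invariance of the functionals under equality of coefficients.

infix 4 _≟ₑ_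
_≟ₑ_ : ∀ {n} (α β : Exponent n) → Dec (α ≡ β)
_≟ₑ_ = Vec.≡-dec ℕ._≟_

-- The coefficient-wise form of pair, which visibly respects _≈ₚ_ ; it equals pair
-- as soon as U lists every exponent of p exactly once.
pairOver : ∀ {n} → (Exponent n → ℚ) → List (Exponent n) → Poly n → ℝ
pairOver φ U p = foldr (λ α v → coeff p α *ᴿ fromℚ (φ α) +ᴿ v) 0ℝ U

pairOver-[] : ∀ {n} (φ : Exponent n → ℚ) U → pairOver φ U [] ≐ 0ℝ
pairOver-[] φ []      N = refl
pairOver-[] φ (α ∷ U) N = trans (cong₂ ℚ._+_ (ℚ.*-zeroˡ (φ α)) (pairOver-[] φ U N)) (ℚ.+-identityˡ 0ℚ)

coeff-≡ : ∀ {n} c (γ : Exponent n) p → coeff ((c , γ) ∷ p) γ ≡ c +ᴿ coeff p γ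
coeff-≡ c γ p = cong (λ b → if b then c +ᴿ coeff p γ else coeff p γ) (dec-true (γ ≟ₑ γ) refl)

coeff-≢ : ∀ {n} c {γ α : Exponent n} p → γ ≢ α → coeff ((c , γ) ∷ p) α ≡ coeff p α
coeff-≢ c {γ} {α} p γ≢α = cong (λ b → if b then c +ᴿ coeff p α else coeff p α) (dec-false (γ ≟ₑ α) γ≢α)

pairOver-∉ : ∀ {n} (φ : Exponent n → ℚ) {U} c {γ} p → All (γ ≢_) U →
  pairOver φ U ((c , γ) ∷ p) ≐ pairOver φ U p
pairOver-∉ φ {[]}    c p []             N = refl
pairOver-∉ φ {α ∷ U} c p (γ≢α ∷ γ∉U) N =
  cong₂ ℚ._+_ (cong (λ x → seq x N ℚ.* φ α) (coeff-≢ c p γ≢α)) (pairOver-∉ φ c p γ∉U N)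

-- Membership makes the head term contribute at some entry of `U`, and uniqueness prevents a second
-- contribution.
pairOver-∷ : ∀ {n} (φ : Exponent n → ℚ) {U} c {γ} p → Unique U → γ ∈ U →
  pairOver φ U ((c , γ) ∷ p) ≐ c *ᴿ fromℚ (φ γ) +ᴿ pairOver φ U p
pairOver-∷ φ {γ ∷ U} c p (γ∉U ∷ _) (here refl) N =
  trans (cong₂ ℚ._+_ (cong (λ x → seq x N ℚ.* φ γ) (coeff-≡ c γ p)) (pairOver-∉ φ c p γ∉U N))
        (solve 4 (λ c x f v → (c :+ x) :* f :+ v := c :* f :+ (x :* f :+ v)) refl
               (seq c N) (seq (coeff p γ) N) (φ γ) _)
  where open +-*-Solver
pairOver-∷ φ {α ∷ U} c {γ} p (α∉U ∷ U!) (there γ∈U) N =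
  trans (cong₂ ℚ._+_ (cong (λ x → seq x N ℚ.* φ α) (coeff-≢ c p (lookup α∉U γ∈U ∘ sym))) (pairOver-∷ φ c p U! γ∈U N))
        (solve 3 (λ a b v → a :+ (b :+ v) := b :+ (a :+ v)) refl
               (seq (coeff p α) N ℚ.* φ α) (seq c N ℚ.* φ γ) _)
  where open +-*-Solver

pairOver≐pair : ∀ {n} (φ : Exponent n → ℚ) {U} p → Unique U → All (_∈ U) (map proj₂ p) →
  pairOver φ U p ≐ pair φ p
pairOver≐pair φ {U} []        U! []          N = pairOver-[] φ U N
pairOver≐pair φ ((c , γ) ∷ p) U! (γ∈U ∷ p⊆U) N =
  trans (pairOver-∷ φ c p U! γ∈U N) (cong (seq c N ℚ.* φ γ ℚ.+_) (pairOver≐pair φ p U! p⊆U N))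

pairOver-cong : ∀ {n} (φ : Exponent n → ℚ) U p q → p ≈ₚ q → pairOver φ U p ≈ᴿ pairOver φ U q
pairOver-cong φ []      p q p≈q = ≐⇒≈ λ _ → refl
pairOver-cong φ (α ∷ U) p q p≈q = +-cong (*-congʳ (φ α) (p≈q α)) (pairOver-cong φ U p q p≈q)

-- `pair` follows the list of terms, whereas `_≈ₚ_` sees only collected coefficients. Both sides are
-- therefore rewritten over one duplicate-free list `U` containing the exponents of `p` and of `q`,
-- where they can be compared entry by entry.
pair-cong : ∀ {n} (φ : Exponent n → ℚ) p q → p ≈ₚ q → pair φ p ≈ᴿ pair φ q
pair-cong φ p q p≈q =
  ≈-trans (≈-sym (≐⇒≈ (pairOver≐pair φ p U! (tabulate (∈-deduplicate⁺ _≟ₑ_ ∘ ∈-++⁺ˡ)))))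
    (≈-trans (pairOver-cong φ U p q p≈q)
             (≐⇒≈ (pairOver≐pair φ q U! (tabulate (∈-deduplicate⁺ _≟ₑ_ ∘ ∈-++⁺ʳ (map proj₂ p))))))
  where
  U = deduplicate _≟ₑ_ (map proj₂ p ++ map proj₂ q)
  U! : Unique U
  U! = UniqueDec.deduplicate-! _≟ₑ_ (map proj₂ p ++ map proj₂ q)

-- Even monomials in the SONC cone.

even-power-nonneg : ∀ p {k} → 2 ∣ k → 0ℚ ℚ.≤ p ^ k
even-power-nonneg p (ℕ.divides j refl) = subst (0ℚ ℚ.≤_)
  (trans (cong (p ^ j ℚ.*_) (sym (ℚ.*-identityʳ (p ^ j)))) (^-assocʳ p j 2))
  (0≤p*p (p ^ j))

seq-^ : ∀ x k N → seq (x ^ᴿ k) N ≡ seq x N ^ k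
seq-^ x zero    N = refl
seq-^ x (suc k) N = cong (seq x N ℚ.*_) (seq-^ x k N)

∏-nonneg : ∀ {k} (x : Vector ℝ k) N → (∀ i → 0ℚ ℚ.≤ seq (x i) N) → 0ℚ ℚ.≤ seq (∏ x) N
∏-nonneg {zero}  x N 0≤x = ℚ.nonNegative⁻¹ 1ℚ
∏-nonneg {suc k} x N 0≤x = 0≤* (0≤x zero) (∏-nonneg (x ∘ suc) N (0≤x ∘ suc))

even-monomial-nonneg : ∀ {n} (α : Exponent n) → EvenExponent α → Nonnegative (monomial 1ℝ α)
even-monomial-nonneg α even x = 0≤-pointwise λ N →
  subst (0ℚ ℚ.≤_) (sym (trans (ℚ.+-identityʳ _) (ℚ.*-identityˡ _)))
    (∏-nonneg (λ i → x i ^ᴿ Vec.lookup α i) N λ i →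
      subst (0ℚ ℚ.≤_) (sym (seq-^ (x i) (Vec.lookup α i) N)) (even-power-nonneg (seq (x i) N) (even i)))

-- The simplex degenerates to one vertex, which is its own relative interior; the inner term sits on
-- that vertex with coefficient 0.
even-monomial-isCircuit : ∀ {n} {α : Exponent n} → EvenExponent α → IsCircuitPolynomial (monomial 1ℝ α)
even-monomial-isCircuit {α = α} even = record
  { r          = 0
  ; r≤n        = z≤n
  ; α          = λ _ → α
  ; β          = α
  ; f-α        = λ _ → 1ℝ
  ; f-β        = 0ℝ
  ; f-α-pos    = λ _ → 0<1ℝ
  ; α-even     = λ _ → even
  ; α-affIndep = λ { c ∑c≈0 _ zero → ≈-trans (≐⇒≈ λ n → sym (ℚ.+-identityʳ (seq (c zero) n))) ∑c≈0 }
  ; β-interior = (λ _ → 1ℝ) , (λ _ → 0<1ℝ) , ≐⇒≈ (λ _ → refl) ,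
                 λ i → ≐⇒≈ λ _ → trans (ℚ.+-identityʳ _) (ℚ.*-identityˡ _)
  ; f-form     = form
  }
  where
  0<1ℝ : 0ℝ <ᴿ 1ℝ
  0<1ℝ = mk< 1ℚ (ℚ.positive⁻¹ 1ℚ) (always λ _ → ℚ.≤-refl)
  form : monomial 1ℝ α ≈ₚ circuitForm (λ (_ : Fin 1) → 1ℝ) (λ _ → α) 0ℝ α
  form γ with does (α ≟ₑ γ)
  ... | true  = ≐⇒≈ λ _ → refl
  ... | false = ≐⇒≈ λ _ → refl

even-monomial∈C : ∀ {n D} {α : Exponent n} → EvenExponent α → ∣ α ∣ₑ ≤ D → C n D (monomial 1ℝ α)
even-monomial∈C {n} {D} {α} even ∣α∣≤D = record
  { degree        = degree
  ; k             = 1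
  ; k-nonZero     = _
  ; μ             = λ _ → 1ℝ
  ; q             = λ _ → monomial 1ℝ α
  ; μ-nonneg      = λ _ → 0≤-pointwise λ _ → ℚ.nonNegative⁻¹ 1ℚ
  ; q-circuit     = λ _ → even-monomial-isCircuit even
  ; q-nonneg      = λ _ → even-monomial-nonneg α even
  ; decomposition = decomposition
  }
  where
  degree : DegreeAtMost D (monomial 1ℝ α)
  degree γ D<∣γ∣ with α ≟ₑ γ
  ... | yes refl = ⊥-elim (ℕ.<⇒≱ D<∣γ∣ ∣α∣≤D)
  ... | no  _    = ≐⇒≈ λ _ → refl
  decomposition : monomial 1ℝ α ≈ₚ monomial (1ℝ *ᴿ 1ℝ) (Vec.replicate n 0 ⊕ α)
  decomposition γ rewrite ⊕-identityˡ α with does (α ≟ₑ γ)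
  ... | true  = ≐⇒≈ λ _ → refl
  ... | false = ≐⇒≈ λ _ → refl

-- Point evaluations and comparison of functionals on circuit polynomials.

point : ∀ {m} → ℚ → Vector ℝ (suc m)
point u zero    = fromℚ u
point u (suc _) = 1ℝ

1^ : ∀ k N → seq (1ℝ ^ᴿ k) N ≡ 1ℚ
1^ zero    N = refl
1^ (suc k) N = trans (ℚ.*-identityˡ _) (1^ k N)

∏1^ : ∀ {m} (γ : Exponent m) N → seq (∏ λ i → 1ℝ ^ᴿ Vec.lookup γ i) N ≡ 1ℚ
∏1^ []      N = refl
∏1^ (k ∷ γ) N = trans (cong₂ ℚ._*_ (1^ k N) (∏1^ γ N)) (ℚ.*-identityˡ 1ℚ)

-- With all other coordinates equal to 1, the value of a monomial depends on its first exponent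
-- only. This makes evaluation a `pair`, comparable weight by weight with other functionals.
eval-point : ∀ {m} u (p : Poly (suc m)) → eval p (point u) ≐ pair (λ γ → u ^ Vec.head γ) p
eval-point u []                N = refl
eval-point u ((c , k ∷ γ) ∷ p) N = cong₂ ℚ._+_
  (cong (seq c N ℚ.*_) (trans (cong₂ ℚ._*_ (seq-^ (fromℚ u) k N) (∏1^ γ N)) (ℚ.*-identityʳ (u ^ k))))
  (eval-point u p N)

0<⇒eventually-nonneg : ∀ {x} → 0ℝ <ᴿ x → Eventually λ n → 0ℚ ℚ.≤ seq x n
0<⇒eventually-nonneg (mk< g 0<g apart) =
  eventually-map (λ n → ℚ.≤-trans (ℚ.+-mono-≤ (ℚ.≤-refl {0ℚ}) (ℚ.<⇒≤ 0<g))) apart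

-- The outer coefficients are positive, so larger weights increase their terms; the inner
-- coefficient has unknown sign, so the weights must agree at `β`. Positivity of a real controls its
-- terms only from some index on, hence `Eventually`.
pair-circuitForm-mono : ∀ {n k} (φ ψ : Exponent n → ℚ) (a : Vector ℝ k) α b β →
  (∀ j → 0ℝ <ᴿ a j) → (∀ j → φ (α j) ℚ.≤ ψ (α j)) → φ β ≡ ψ β →
  Eventually λ N → seq (pair φ (circuitForm a α b β)) N ℚ.≤ seq (pair ψ (circuitForm a α b β)) N
pair-circuitForm-mono {k = zero}  φ ψ a α b β 0<a φ≤ψ φ≡ψ = always λ N →
  ℚ.≤-reflexive (cong (λ x → seq b N ℚ.* x ℚ.+ 0ℚ) φ≡ψ)
pair-circuitForm-mono {k = suc k} φ ψ a α b β 0<a φ≤ψ φ≡ψ = eventually-map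
  (λ N (0≤a , rest) →
    ℚ.+-mono-≤ (ℚ.*-monoˡ-≤-nonNeg (seq (a zero) N) {{ℚ.nonNegative 0≤a}} (φ≤ψ zero)) rest)
  (both (0<⇒eventually-nonneg (0<a zero))
        (pair-circuitForm-mono φ ψ (a ∘ suc) (α ∘ suc) b β (0<a ∘ suc) (φ≤ψ ∘ suc) φ≡ψ))

-- `q` agrees with its circuit form only up to `_≈ₚ_`, so `pair-cong` moves the hypothesis to the
-- form, where the weights are compared, and moves the conclusion back. In the application `φ` comes
-- from a point evaluation and `ψ` from `χ`.
pair-circuit-nonneg : ∀ {n} {φ ψ : Exponent n → ℚ} {q} (q-circuit : IsCircuitPolynomial q) →
  (∀ α → EvenExponent α → φ α ℚ.≤ ψ α) →
  φ (IsCircuitPolynomial.β q-circuit) ≡ ψ (IsCircuitPolynomial.β q-circuit) →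
  0ℝ ≤ᴿ pair φ q → 0ℝ ≤ᴿ pair ψ q
pair-circuit-nonneg {φ = φ} {ψ} {q} q-circuit φ≤ψ φ≡ψ 0≤φq =
  0≤-resp-≈ (≈-sym (pair-cong ψ q form f-form))
    (0≤-mono (pair-circuitForm-mono φ ψ f-α α f-β β f-α-pos (λ j → φ≤ψ (α j) (α-even j)) φ≡ψ)
      (0≤-resp-≈ (pair-cong φ q form f-form) 0≤φq))
  where
  open IsCircuitPolynomial q-circuit
  form = circuitForm f-α α f-β β

-- The separating functional and its sign on the SONC cone.

-2ℚ -½ 16ℚ : ℚ
-2ℚ = ℚ.- (1ℚ ℚ.+ 1ℚ)
-½  = ℚ.- ½
-- With this factor the weights `-2ℚ ^ k` and `16ℚ ℚ.* -½ ^ k` agree at k = 2, where `χ` passes from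
-- one to the other.
16ℚ = -2ℚ ^ 4

-- χ k = (-1)^k max(2^k, 2^(4-k)), hence 16 (-1/2)^k for k ≤ 2.
χ : ℕ → ℚ
χ 0               = 16ℚ
χ 1               = -2ℚ ^ 3
χ k@(suc (suc _)) = -2ℚ ^ k

[-2]^≤χ : ∀ {k} → 2 ∣ k → -2ℚ ^ k ℚ.≤ χ k
[-2]^≤χ {0}           _ = from-yes (1ℚ ℚ.≤? 16ℚ)
[-2]^≤χ {1}           2∣1 with () ← ℕ.∣1⇒≡1 2∣1
[-2]^≤χ {suc (suc k)} _ = ℚ.≤-refl

-- Both sides are 4 at exponent 2, and raising the exponent by 2 multiplies the left side by 1/4 and
-- the right side by 4. The exponent starts at 2 because the inequality fails at 0.
16[-½]^≤[-2]^ : ∀ j → 16ℚ ℚ.* -½ ^ (suc j ℕ.* 2) ℚ.≤ -2ℚ ^ (suc j ℕ.* 2)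
16[-½]^≤[-2]^ zero    = from-yes (16ℚ ℚ.* -½ ^ 2 ℚ.≤? -2ℚ ^ 2)
16[-½]^≤[-2]^ (suc j) = begin
  16ℚ ℚ.* (-½ ℚ.* (-½ ℚ.* h))
    ≡⟨ solve 3 (λ s c h → s :* (c :* (c :* h)) := (c :* c) :* (s :* h)) refl 16ℚ -½ h ⟩
  -½ ℚ.* -½ ℚ.* (16ℚ ℚ.* h)
    ≤⟨ ℚ.*-monoˡ-≤-nonNeg (-½ ℚ.* -½) (16[-½]^≤[-2]^ j) ⟩
  -½ ℚ.* -½ ℚ.* t
    ≤⟨ ℚ.*-monoʳ-≤-nonNeg t {{ℚ.nonNegative (even-power-nonneg -2ℚ (ℕ.divides (suc j) refl))}}
         (from-yes (-½ ℚ.* -½ ℚ.≤? -2ℚ ℚ.* -2ℚ)) ⟩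
  -2ℚ ℚ.* -2ℚ ℚ.* t
    ≡⟨ ℚ.*-assoc -2ℚ -2ℚ t ⟩
  -2ℚ ℚ.* (-2ℚ ℚ.* t) ∎
  where
  open ℚ.≤-Reasoning
  open +-*-Solver
  h = -½ ^ (suc j ℕ.* 2)
  t = -2ℚ ^ (suc j ℕ.* 2)

16[-½]^≤χ : ∀ {k} → 2 ∣ k → 16ℚ ℚ.* -½ ^ k ℚ.≤ χ k
16[-½]^≤χ (ℕ.divides zero    refl) = ℚ.≤-reflexive refl
16[-½]^≤χ (ℕ.divides (suc j) refl) = 16[-½]^≤[-2]^ j

pair-χ-nonneg : ∀ {m} {q : Poly (suc m)} → IsCircuitPolynomial q → Nonnegative q →
  0ℝ ≤ᴿ pair (χ ∘ Vec.head) q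
pair-χ-nonneg {q = q} q-circuit 0≤q = split _ refl
  where
  open IsCircuitPolynomial q-circuit using (β)

  head-even : ∀ {m} (α : Exponent (suc m)) → EvenExponent α → 2 ∣ Vec.head α
  head-even (_ ∷ _) even = even zero

  at-[-2] : 0ℝ ≤ᴿ pair (λ γ → -2ℚ ^ Vec.head γ) q
  at-[-2] = 0≤-resp-≈ (≐⇒≈ (eval-point -2ℚ q)) (0≤q (point -2ℚ))

  at-[-½] : 0ℝ ≤ᴿ pair (λ γ → 16ℚ ℚ.* -½ ^ Vec.head γ) q
  at-[-½] = 0≤-resp-≈
    (≐⇒≈ λ N → trans (cong (16ℚ ℚ.*_) (eval-point -½ q N)) (sym (pair-scale 16ℚ (λ γ → -½ ^ Vec.head γ) q N)))
    (0≤*ᴿ {fromℚ 16ℚ} (0≤-pointwise λ _ → ℚ.nonNegative⁻¹ 16ℚ) (0≤q (point -½)))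

  by-[-2] : -2ℚ ^ Vec.head β ≡ χ (Vec.head β) → 0ℝ ≤ᴿ pair (χ ∘ Vec.head) q
  by-[-2] eq = pair-circuit-nonneg q-circuit (λ α → [-2]^≤χ ∘ head-even α) eq at-[-2]

  by-[-½] : 16ℚ ℚ.* -½ ^ Vec.head β ≡ χ (Vec.head β) → 0ℝ ≤ᴿ pair (χ ∘ Vec.head) q
  by-[-½] eq = pair-circuit-nonneg q-circuit (λ α → 16[-½]^≤χ ∘ head-even α) eq at-[-½]

  -- The weight from -1/2 is exact at 0 and 1, the weight from -2 from 2 onwards. Naming the first
  -- exponent of `β` as `k` lets `χ` compute in each clause.
  split : ∀ k → Vec.head β ≡ k → 0ℝ ≤ᴿ pair (χ ∘ Vec.head) q
  split 0             eq = by-[-½] (subst (λ k → 16ℚ ℚ.* -½ ^ k ≡ χ k) (sym eq) refl)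
  split 1             eq = by-[-½] (subst (λ k → 16ℚ ℚ.* -½ ^ k ≡ χ k) (sym eq) refl)
  split (suc (suc j)) eq = by-[-2] (subst (λ k → -2ℚ ^ k ≡ χ k) (sym eq) refl)

∑-nonneg : ∀ {k} (x : Vector ℝ k) → (∀ i → 0ℝ ≤ᴿ x i) → 0ℝ ≤ᴿ ∑ x
∑-nonneg {zero}  x 0≤x = 0≤-pointwise λ _ → ℚ.≤-refl
∑-nonneg {suc k} x 0≤x = 0≤+ (0≤x zero) (∑-nonneg (x ∘ suc) (0≤x ∘ suc))

-- A SONC decomposition is a sum of nonnegative multiples and `pair` is linear, so the bound for
-- circuit polynomials suffices.
pair-χ-SONC-nonneg : ∀ {m D} {f : Poly (suc m)} → C (suc m) D f → 0ℝ ≤ᴿ pair (χ ∘ Vec.head) f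
pair-χ-SONC-nonneg {f = f} f∈C =
  0≤-resp-≈ (≈-sym (pair-cong φ f (∑ₚ terms) decomposition))
    (0≤-resp-≈ (≐⇒≈ (λ N → sym (pair-∑ₚ φ terms N)))
      (∑-nonneg _ λ i →
        0≤-resp-≈ (≐⇒≈ (λ N → sym (pair-const-* φ (μ i) (q i) N)))
          (0≤*ᴿ (μ-nonneg i) (pair-χ-nonneg (q-circuit i) (q-nonneg i)))))
  where
  open C f∈C
  φ = χ ∘ Vec.head
  terms = λ i → const (μ i) *ₚ q i

-- Translation of the first variable and powers of x₁ + 1.

∑-cong-≐ : ∀ {k} (x y : Vector ℝ k) → (∀ i → x i ≐ y i) → ∑ x ≐ ∑ y
∑-cong-≐ {zero}  x y x≐y N = refl
∑-cong-≐ {suc k} x y x≐y N = cong₂ ℚ._+_ (x≐y zero N) (∑-cong-≐ (x ∘ suc) (y ∘ suc) (x≐y ∘ suc) N)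

∑-0* : ∀ {k} (x : Vector ℝ k) → ∑ (λ i → 0ℝ *ᴿ x i) ≐ 0ℝ
∑-0* {zero}  x N = refl
∑-0* {suc k} x N = trans (cong₂ ℚ._+_ (ℚ.*-zeroˡ (seq (x zero) N)) (∑-0* (x ∘ suc) N)) (ℚ.+-identityˡ 0ℚ)

∑-identityMatrix : ∀ {n} i (x : Vector ℝ n) → ∑ (λ j → identityMatrix i j *ᴿ x j) ≐ x i
∑-identityMatrix zero    x N =
  trans (cong₂ ℚ._+_ (ℚ.*-identityˡ (seq (x zero) N)) (∑-0* (x ∘ suc) N)) (ℚ.+-identityʳ _)
-- The head entry of row `suc i` is 0, and the remaining entries form row `i` by computation.
∑-identityMatrix (suc i) x N =
  trans (cong₂ ℚ._+_ (ℚ.*-zeroˡ (seq (x zero) N)) (∑-identityMatrix i (x ∘ suc) N)) (ℚ.+-identityˡ _)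

translation : ∀ {m} → AffineMap (suc m)
translation = record { A = identityMatrix ; b = λ { zero → 1ℝ ; (suc _) → 0ℝ } }

translation-invertible : ∀ {m} → Invertible (translation {m})
translation-invertible = identityMatrix , inverse , inverse
  where
  inverse : ∀ i j → matMul identityMatrix identityMatrix i j ≈ᴿ identityMatrix i j
  inverse i j = ≐⇒≈ (∑-identityMatrix i λ k → identityMatrix k j)

-- ∑ᵢ (k choose i) g i, by Pascal's rule.
binomialSum : ℕ → (ℕ → ℚ) → ℚ
binomialSum zero    g = g 0
binomialSum (suc k) g = binomialSum k (g ∘ suc) ℚ.+ binomialSum k g

module _ (m : ℕ) where

  x₀+1 : Poly (suc m)
  x₀+1 = component translation zero

  -- `component` yields a term for every variable, all but the first with coefficient 0; summing
  -- against a row of the identity matrix discards these.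
  pair-x₀+1 : ∀ (φ : Exponent (suc m) → ℚ) N →
    seq (pair φ x₀+1) N ≡ φ (1 ∷ Vec.replicate m 0) ℚ.+ φ (Vec.replicate (suc m) 0)
  pair-x₀+1 φ N = trans (pair-++ φ (∑ₚ terms) _ N) (cong₂ ℚ._+_ linear (trans (pair-const φ 1ℝ N) (ℚ.*-identityˡ _)))
    where
    terms : Fin (suc m) → Poly (suc m)
    terms j = const (identityMatrix zero j) *ₚ var j
    scaled : Fin (suc m) → ℝ
    scaled j = identityMatrix zero j *ᴿ pair φ (var j)
    open ≡-Reasoning
    linear : seq (pair φ (∑ₚ terms)) N ≡ φ (1 ∷ Vec.replicate m 0)
    linear = begin
      seq (pair φ (∑ₚ terms)) N
        ≡⟨ pair-∑ₚ φ terms N ⟩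
      seq (∑ (pair φ ∘ terms)) N
        ≡⟨ ∑-cong-≐ (pair φ ∘ terms) scaled (λ j → pair-const-* φ (identityMatrix zero j) (var j)) N ⟩
      seq (∑ scaled) N
        ≡⟨ ∑-identityMatrix zero (pair φ ∘ var) N ⟩
      1ℚ ℚ.* φ (1 ∷ Vec.replicate m 0) ℚ.+ 0ℚ
        ≡⟨ trans (ℚ.+-identityʳ _) (ℚ.*-identityˡ _) ⟩
      φ (1 ∷ Vec.replicate m 0) ∎

  -- Multiplying by x₁ + 1 replaces the weight `g` by the sum of its shift and itself, which is the
  -- recursion of `binomialSum`. The weight stays arbitrary because the induction shifts it.
  pair-[x₀+1]^ : ∀ k g N → seq (pair (g ∘ Vec.head) (x₀+1 ^ₚ k)) N ≡ binomialSum k g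
  pair-[x₀+1]^ zero    g N = trans (pair-const {suc m} (g ∘ Vec.head) 1ℝ N) (ℚ.*-identityˡ (g 0))
  pair-[x₀+1]^ (suc k) g N =
    trans (pair-* φ x₀+1 (x₀+1 ^ₚ k) N)
      (trans (pair-x₀+1 (λ α → seq (pair (λ β → φ (α ⊕ β)) (x₀+1 ^ₚ k)) N) N)
        (cong₂ ℚ._+_
          -- The first exponent of `α ⊕ β` reduces only once `β` is a cons; then the exponent of x₁
          -- shifts `g` and the zero exponent leaves it unchanged.
          (trans (pair-ext (λ { (_ ∷ _) → refl }) (x₀+1 ^ₚ k) N) (pair-[x₀+1]^ k (g ∘ suc) N))
          (trans (pair-ext (λ { (_ ∷ _) → refl }) (x₀+1 ^ₚ k) N) (pair-[x₀+1]^ k g N))))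
    where φ = g ∘ Vec.head

-- Each factor is `const 1ℝ`. The exponents are a function with pointwise proofs because
-- `Vec.lookup (Vec.replicate m 0) i` does not reduce for a variable `i`.
pair-∏ₚ-^0 : ∀ {n k} (φ : Exponent n → ℚ) (p : Vector (Poly n) k) (e : Vector ℕ k) → (∀ i → e i ≡ 0) → ∀ N →
  seq (pair φ (∏ₚ λ i → p i ^ₚ e i)) N ≡ φ (Vec.replicate n 0)
pair-∏ₚ-^0 {n} {zero}  φ p e e≡0 N = trans (pair-const φ 1ℝ N) (ℚ.*-identityˡ (φ (Vec.replicate n 0)))
pair-∏ₚ-^0 {n} {suc k} φ p e e≡0 N rewrite e≡0 zero =
  trans (pair-const-* φ 1ℝ (∏ₚ λ i → p (suc i) ^ₚ e (suc i)) N) (trans (ℚ.*-identityˡ _) (pair-∏ₚ-^0 φ (p ∘ suc) (e ∘ suc) (e≡0 ∘ suc) N))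

-- The quartic monomial and its translate.

quartic : ∀ {m} → Exponent (suc m)
quartic {m} = 4 ∷ Vec.replicate m 0

quartic-even : ∀ {m} → EvenExponent (quartic {m})
quartic-even     zero    = ℕ.divides 2 refl
quartic-even {m} (suc i) = subst (2 ∣_) (sym (Vec.lookup-replicate i 0)) (ℕ.divides 0 refl)

∣quartic∣ : ∀ m → ∣ quartic {m} ∣ₑ ≡ 4
∣quartic∣ m = cong (4 ℕ.+_) (sum0 m)
  where
  sum0 : ∀ m → Vec.sum (Vec.replicate m 0) ≡ 0
  sum0 zero    = refl
  sum0 (suc m) = sum0 m

pair-quartic∘translation : ∀ m g N →
  seq (pair (g ∘ Vec.head) (monomial 1ℝ (quartic {m}) ∘ₚ translation)) N ≡ binomialSum 4 g
pair-quartic∘translation m g N = begin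
  -- Substitution into a single term unfolds to this list: `P` comes from the first variable, `R`
  -- from all others.
  seq (pair φ ((const 1ℝ *ₚ (P *ₚ R)) ++ [])) N
    ≡⟨ trans (pair-++ φ (const 1ℝ *ₚ (P *ₚ R)) [] N) (ℚ.+-identityʳ _) ⟩
  seq (pair φ (const 1ℝ *ₚ (P *ₚ R))) N
    ≡⟨ trans (pair-const-* φ 1ℝ (P *ₚ R) N) (ℚ.*-identityˡ _) ⟩
  seq (pair φ (P *ₚ R)) N
    ≡⟨ pair-* φ P R N ⟩
  seq (pair (λ α → seq (pair (λ β → φ (α ⊕ β)) R) N) P) N
    -- The other variables enter with exponent 0, so the inner functional returns `φ α` and `R`
    -- disappears.
    ≡⟨ pair-ext (λ α → trans
         (pair-∏ₚ-^0 (λ β → φ (α ⊕ β)) (component translation ∘ suc) (Vec.lookup (Vec.replicate m 0))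
           (λ i → Vec.lookup-replicate i 0) N)
         (cong φ (⊕-identityʳ α))) P N ⟩
  seq (pair φ P) N
    ≡⟨ pair-[x₀+1]^ m 4 g N ⟩
  binomialSum 4 g ∎
  where
  open ≡-Reasoning
  φ = g ∘ Vec.head
  P = x₀+1 m ^ₚ 4
  R = ∏ₚ λ i → component (translation {m}) (suc i) ^ₚ Vec.lookup (Vec.replicate m 0) i

corollary3p2 : (d : ℕ) → 2 ∣ d → 4 ≤ d → (n : ℕ) → NonZero n →
    Σ (Poly n) λ f → Σ (AffineMap n) λ T →
    C n d f × Invertible T × ¬ (C n d (f ∘ₚ T))
corollary3p2 d _ 4≤d (suc m) _ =
  monomial 1ℝ quartic , translation ,
  even-monomial∈C quartic-even (subst (_≤ d) (sym (∣quartic∣ m)) 4≤d) ,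
  translation-invertible ,
  λ f∘T∈C → pair-χ-negative (pair-χ-SONC-nonneg f∘T∈C)
  where
  pair-χ-negative : ¬ (0ℝ ≤ᴿ pair (χ ∘ Vec.head) (monomial 1ℝ (quartic {m}) ∘ₚ translation))
  -- `binomialSum 4 χ` evaluates to -8, so the tolerance 1 already gives the false inequality 0 ≤
  -- -7.
  pair-χ-negative (mk≤ 0≤) with N , below ← 0≤ 1ℚ (ℚ.positive⁻¹ 1ℚ) =
    from-no (0ℚ ℚ.≤? binomialSum 4 χ ℚ.+ 1ℚ)
      (subst (λ x → 0ℚ ℚ.≤ x ℚ.+ 1ℚ) (pair-quartic∘translation m χ N) (below N ℕ.≤-refl))
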